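{- Let $s,t\geq 1$ be integers and let $p,q,l$ be three distinct primes with $p,q$ odd, $p\equiv 3 \pmod 4$, $\mathrm{ord}_{p^s}(l)=\phi(p^s)/2$, $\mathrm{ord}_{q^t}(l)=\phi(q^t)$ and $\gcd(\phi(p^s),\phi(q^t))=2$. Let $0\leq j\leq t-1$. Then in the ring $\mathbb{F}_l[x]/\langle x^{p^sq^t}-1\rangle$: \[\chi_{sj}^2=(q-2)q^{t-j-1}\chi_{sj}+\phi(q^{t-j})\sum_{j<m\leq t}\chi_{sm}.\]
   Context: Here $\phi$ is Euler's phi function (with $\phi(1)=1$) and $\mathrm{ord}_m(k)$ is the multiplicative order of $k$ modulo $m$. Put $n=p^sq^t$. For an integer $\gamma$, $C_\gamma=\{\gamma l^r \bmod n: r\geq 0\}\subseteq \mathbb{Z}_n$ is the $l$-cyclotomic coset modulo $n$ containing $\gamma$. For $0\leq j\leq t$ set $C_{sj}=C_{p^sq^j}$, so $C_{st}=C_0=\{0\}$, and define the element $\chi_{sj}=\sum_{\alpha\in C_{sj}}x^\alpha$ of $\mathbb{F}_l[x]/\langle x^{n}-1\rangle$; in particular $\chi_{st}=1$. Integer coefficients are read in $\mathbb{F}_l$. -}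

module Defs where

open import Algebra.Bundles using (AbelianGroup; CommutativeRing)
open import Data.Fin.Base as Fin using (Fin; toℕ; fromℕ<)
import Data.Fin.Properties as Fin
open import Data.Integer.Base as ℤ using (ℤ; +_; _%ℕ_; _/ℕ_)
import Data.Integer.Divisibility.Signed as ℤ
import Data.Integer.DivMod as ℤ
import Data.Integer.Properties as ℤ
open import Data.List.Base using (List; []; _∷_; map; filter; foldr; length; allFin; applyUpTo)
open import Data.Nat.Base as ℕ using (ℕ; zero; suc; _≤_; _<_)
open import Data.Nat.Coprimality using (coprime?)
open import Data.Nat.Induction using (<-rec)
import Data.Nat.Properties as ℕ
open import Data.Product.Base using (∃; _×_; _,_)
open import Level using (Level; 0ℓ; _⊔_)
open import Relation.Binary.PropositionalEquality.Core as ≡ using (_≡_)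
open import Relation.Binary.Structures using (IsEquivalence)
open import Relation.Nullary using (Dec)
open import Relation.Nullary.Decidable using (map′)
open import Relation.Nullary.Decidable.Core using (yes; no)
open import Relation.Unary using (Pred; Decidable)
import Algebra.Properties.AbelianGroup as AbelianGroupProperties
import Algebra.Properties.CommutativeSemigroup as CommutativeSemigroupProperties
import Algebra.Properties.Ring as RingProperties
import Algebra.Properties.Semiring.Divisibility as Divisibility
import Algebra.Properties.Semiring.Exp as Exp
import Relation.Binary.Reasoning.Setoid as ≈-Reasoning

module Quotient {c ℓ : Level} (R : CommutativeRing c ℓ) (a : CommutativeRing.Carrier R) where
  open CommutativeRing R
  open RingProperties ring
  open Divisibility semiring using (_∣_; _,_; _∣0; ∣ʳ-respʳ-≈; x∣ʳy⇒x∣ʳzy)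
  open CommutativeSemigroupProperties +-commutativeSemigroup using (interchange)
  open ≈-Reasoning setoid

  -- A record, so that x and y can be inferred from x ∼ y.
  infix 4 _∼_
  record _∼_ (x y : Carrier) : Set (c ⊔ ℓ) where
    constructor congruent
    field a∣x-y : a ∣ x - y
  open _∼_ public

  private
    ∣-+ : ∀ {x y} → a ∣ x → a ∣ y → a ∣ x + y
    ∣-+ (u , ua≈x) (v , va≈y) = u + v , trans (distribʳ a u v) (+-cong ua≈x va≈y)

    ∣-neg : ∀ {x} → a ∣ x → a ∣ - x
    ∣-neg (u , ua≈x) = - u , trans (sym (-‿distribˡ-* u a)) (-‿cong ua≈x)

    ≈⇒∼ : ∀ {x y} → x ≈ y → x ∼ y
    ≈⇒∼ {x} {y} x≈y = congruent (∣ʳ-respʳ-≈ (sym (trans (+-congʳ x≈y) (-‿inverseʳ y))) (a ∣0))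

    ∼-trans : ∀ {x y z} → x ∼ y → y ∼ z → x ∼ z
    ∼-trans {x} {y} {z} (congruent x∼y) (congruent y∼z) = congruent (∣ʳ-respʳ-≈ (begin
      (x - y) + (y - z)    ≈⟨ +-assoc x (- y) (y - z) ⟩
      x + (- y + (y - z))  ≈⟨ +-congˡ (+-assoc (- y) y (- z)) ⟨
      x + ((- y + y) - z)  ≈⟨ +-congˡ (+-congʳ (-‿inverseˡ y)) ⟩
      x + (0# - z)         ≈⟨ +-congˡ (+-identityˡ (- z)) ⟩
      x - z                ∎) (∣-+ x∼y y∼z))

    ∼-isEquivalence : IsEquivalence _∼_
    ∼-isEquivalence = record
      { refl  = ≈⇒∼ refl
      ; sym   = λ {x} {y} x∼y → congruent (∣ʳ-respʳ-≈ (⁻¹-anti-homo‿- x y) (∣-neg (a∣x-y x∼y)))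
      ; trans = ∼-trans
      }

    +-cong′ : ∀ {x y u v} → x ∼ y → u ∼ v → x + u ∼ y + v
    +-cong′ {x} {y} {u} {v} (congruent x∼y) (congruent u∼v) = congruent (∣ʳ-respʳ-≈ (begin
      (x - y) + (u - v)      ≈⟨ interchange x (- y) u (- v) ⟩
      (x + u) + (- y + - v)  ≈⟨ +-congˡ (-‿+-comm y v) ⟩
      (x + u) - (y + v)      ∎) (∣-+ x∼y u∼v))

    *-congˡ′ : ∀ z {x y} → x ∼ y → z * x ∼ z * y
    *-congˡ′ z {x} {y} (congruent x∼y) =
      congruent (∣ʳ-respʳ-≈ (x[y-z]≈xy-xz z x y) (x∣ʳy⇒x∣ʳzy z x∼y))

    *-cong′ : ∀ {x y u v} → x ∼ y → u ∼ v → x * u ∼ y * v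
    *-cong′ {x} {y} {u} {v} x∼y u∼v =
      ∼-trans (≈⇒∼ (*-comm x u))
        (∼-trans (*-congˡ′ u x∼y)
          (∼-trans (≈⇒∼ (*-comm u y)) (*-congˡ′ y u∼v)))

    -‿cong′ : ∀ {x y} → x ∼ y → - x ∼ - y
    -‿cong′ {x} {y} (congruent x∼y) =
      congruent (∣ʳ-respʳ-≈ (sym (-‿+-comm x (- y))) (∣-neg x∼y))

  commutativeRing : CommutativeRing c (c ⊔ ℓ)
  commutativeRing = record
    { Carrier = Carrier
    ; _≈_     = _∼_
    ; _+_     = _+_
    ; _*_     = _*_
    ; -_      = -_
    ; 0#      = 0#
    ; 1#      = 1#
    ; isCommutativeRing = record
      { isRing = record
        { +-isAbelianGroup = record
          { isGroup = record
            { isMonoid = record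
              { isSemigroup = record
                { isMagma = record
                  { isEquivalence = ∼-isEquivalence
                  ; ∙-cong        = +-cong′
                  }
                ; assoc = λ x y z → ≈⇒∼ (+-assoc x y z)
                }
              ; identity = (λ x → ≈⇒∼ (+-identityˡ x)) , λ x → ≈⇒∼ (+-identityʳ x)
              }
            ; inverse = (λ x → ≈⇒∼ (-‿inverseˡ x)) , λ x → ≈⇒∼ (-‿inverseʳ x)
            ; ⁻¹-cong = -‿cong′
            }
          ; comm = λ x y → ≈⇒∼ (+-comm x y)
          }
        ; *-cong     = *-cong′
        ; *-assoc    = λ x y z → ≈⇒∼ (*-assoc x y z)
        ; *-identity = (λ x → ≈⇒∼ (*-identityˡ x)) , λ x → ≈⇒∼ (*-identityʳ x)
        ; distrib    = (λ x y z → ≈⇒∼ (distribˡ x y z)) , λ x y z → ≈⇒∼ (distribʳ x y z)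
        }
      ; *-comm = λ x y → ≈⇒∼ (*-comm x y)
      }
    }

infix 8 _/⟨_⟩
_/⟨_⟩ : ∀ {c ℓ} (R : CommutativeRing c ℓ) → CommutativeRing.Carrier R → CommutativeRing c (c ⊔ ℓ)
R /⟨ a ⟩ = Quotient.commutativeRing R a

module Polynomial {c ℓ : Level} (R : CommutativeRing c ℓ) where
  open CommutativeRing R
  private module R = RingProperties ring

  -- Coefficients in order of increasing degree; trailing zeros are allowed.
  Poly : Set c
  Poly = List Carrier

  coeff : Poly → ℕ → Carrier
  coeff []      k       = 0#
  coeff (a ∷ f) zero    = a
  coeff (a ∷ f) (suc k) = coeff f k

  infix 4 _≈ₚ_
  record _≈ₚ_ (f g : Poly) : Set ℓ where
    constructor coeffwise
    field at : ∀ k → coeff f k ≈ coeff g k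
  open _≈ₚ_ public

  infixl 6 _+ₚ_
  infixl 7 _·_ _*ₚ_

  _+ₚ_ : Poly → Poly → Poly
  []      +ₚ g       = g
  (a ∷ f) +ₚ []      = a ∷ f
  (a ∷ f) +ₚ (b ∷ g) = a + b ∷ f +ₚ g

  -ₚ_ : Poly → Poly
  -ₚ f = map (-_) f

  _·_ : Carrier → Poly → Poly
  a · f = map (a *_) f

  _*ₚ_ : Poly → Poly → Poly
  []      *ₚ g = []
  (a ∷ f) *ₚ g = a · g +ₚ (0# ∷ f *ₚ g)

  constₚ : Carrier → Poly
  constₚ a = a ∷ []

  X : Poly
  X = 0# ∷ 1# ∷ []

  coeff-+ : ∀ f g k → coeff (f +ₚ g) k ≈ coeff f k + coeff g k
  coeff-+ []      g       k       = sym (+-identityˡ _)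
  coeff-+ (a ∷ f) []      k       = sym (+-identityʳ _)
  coeff-+ (a ∷ f) (b ∷ g) zero    = refl
  coeff-+ (a ∷ f) (b ∷ g) (suc k) = coeff-+ f g k

  coeff-neg : ∀ f k → coeff (-ₚ f) k ≈ - coeff f k
  coeff-neg []      k       = sym R.-0#≈0#
  coeff-neg (a ∷ f) zero    = refl
  coeff-neg (a ∷ f) (suc k) = coeff-neg f k

  coeff-· : ∀ a f k → coeff (a · f) k ≈ a * coeff f k
  coeff-· a []      k       = sym (zeroʳ a)
  coeff-· a (b ∷ f) zero    = refl
  coeff-· a (b ∷ f) (suc k) = coeff-· a f k

  private
    ≈ₚ-isEquivalence : IsEquivalence _≈ₚ_
    ≈ₚ-isEquivalence = record
      { refl  = coeffwise λ k → refl
      ; sym   = λ p → coeffwise λ k → sym (at p k)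
      ; trans = λ p q → coeffwise λ k → trans (at p k) (at q k)
      }

    module P = IsEquivalence ≈ₚ-isEquivalence

    +ₚ-cong : ∀ {f f′ g g′} → f ≈ₚ f′ → g ≈ₚ g′ → f +ₚ g ≈ₚ f′ +ₚ g′
    +ₚ-cong {f} {f′} {g} {g′} p q = coeffwise λ k →
      trans (coeff-+ f g k)
        (trans (+-cong (at p k) (at q k)) (sym (coeff-+ f′ g′ k)))

    +ₚ-assoc : ∀ f g h → (f +ₚ g) +ₚ h ≈ₚ f +ₚ (g +ₚ h)
    +ₚ-assoc f g h = coeffwise λ k → begin
      coeff ((f +ₚ g) +ₚ h) k              ≈⟨ coeff-+ (f +ₚ g) h k ⟩
      coeff (f +ₚ g) k + coeff h k         ≈⟨ +-congʳ (coeff-+ f g k) ⟩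
      (coeff f k + coeff g k) + coeff h k  ≈⟨ +-assoc _ _ _ ⟩
      coeff f k + (coeff g k + coeff h k)  ≈⟨ +-congˡ (coeff-+ g h k) ⟨
      coeff f k + coeff (g +ₚ h) k         ≈⟨ coeff-+ f (g +ₚ h) k ⟨
      coeff (f +ₚ (g +ₚ h)) k              ∎
      where open ≈-Reasoning setoid

    +ₚ-comm : ∀ f g → f +ₚ g ≈ₚ g +ₚ f
    +ₚ-comm f g = coeffwise λ k →
      trans (coeff-+ f g k) (trans (+-comm _ _) (sym (coeff-+ g f k)))

    +ₚ-identityʳ : ∀ f → f +ₚ [] ≈ₚ f
    +ₚ-identityʳ f = +ₚ-comm f []

    -ₚ‿cong : ∀ {f g} → f ≈ₚ g → -ₚ f ≈ₚ -ₚ g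
    -ₚ‿cong {f} {g} p = coeffwise λ k →
      trans (coeff-neg f k) (trans (-‿cong (at p k)) (sym (coeff-neg g k)))

    -ₚ‿inverseˡ : ∀ f → (-ₚ f) +ₚ f ≈ₚ []
    -ₚ‿inverseˡ f = coeffwise λ k →
      trans (coeff-+ (-ₚ f) f k)
        (trans (+-congʳ (coeff-neg f k)) (-‿inverseˡ _))

    +-abelianGroupₚ : AbelianGroup c ℓ
    +-abelianGroupₚ = record
      { Carrier = Poly
      ; _≈_     = _≈ₚ_
      ; _∙_     = _+ₚ_
      ; ε       = []
      ; _⁻¹     = -ₚ_
      ; isAbelianGroup = record
        { isGroup = record
          { isMonoid = record
            { isSemigroup = record
              { isMagma = record
                { isEquivalence = ≈ₚ-isEquivalence
                ; ∙-cong        = +ₚ-cong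
                }
              ; assoc = +ₚ-assoc
              }
            ; identity = (λ f → P.refl) , +ₚ-identityʳ
            }
          ; inverse = -ₚ‿inverseˡ
                    , λ f → P.trans (+ₚ-comm f (-ₚ f)) (-ₚ‿inverseˡ f)
          ; ⁻¹-cong = -ₚ‿cong
          }
        ; comm = +ₚ-comm
        }
      }

    module +ₚ = AbelianGroup +-abelianGroupₚ
    open CommutativeSemigroupProperties +ₚ.commutativeSemigroup
      using (interchange; x∙yz≈y∙xz)
    open ≈-Reasoning +ₚ.setoid

    ∷-cong : ∀ {a b f g} → a ≈ b → f ≈ₚ g → a ∷ f ≈ₚ b ∷ g
    ∷-cong a≈b p = coeffwise λ { zero → a≈b ; (suc k) → at p k }

    0∷[] : 0# ∷ [] ≈ₚ []
    0∷[] = coeffwise λ { zero → refl ; (suc k) → refl }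

    0∷-+ : ∀ f g → 0# ∷ f +ₚ g ≈ₚ (0# ∷ f) +ₚ (0# ∷ g)
    0∷-+ f g = ∷-cong (sym (+-identityˡ 0#)) P.refl

    ·-cong : ∀ {a b f g} → a ≈ b → f ≈ₚ g → a · f ≈ₚ b · g
    ·-cong {a} {b} {f} {g} a≈b p = coeffwise λ k →
      trans (coeff-· a f k) (trans (*-cong a≈b (at p k)) (sym (coeff-· b g k)))

    ·-distribˡ : ∀ a f g → a · (f +ₚ g) ≈ₚ a · f +ₚ a · g
    ·-distribˡ a f g = coeffwise λ k →
      trans (coeff-· a (f +ₚ g) k)
        (trans (*-congˡ (coeff-+ f g k))
          (trans (distribˡ a _ _)
            (trans (+-cong (sym (coeff-· a f k)) (sym (coeff-· a g k)))
              (sym (coeff-+ (a · f) (a · g) k)))))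

    ·-distribʳ : ∀ a b f → (a + b) · f ≈ₚ a · f +ₚ b · f
    ·-distribʳ a b f = coeffwise λ k →
      trans (coeff-· (a + b) f k)
        (trans (distribʳ _ a b)
          (trans (+-cong (sym (coeff-· a f k)) (sym (coeff-· b f k)))
            (sym (coeff-+ (a · f) (b · f) k))))

    ·-assoc : ∀ a b f → (a * b) · f ≈ₚ a · (b · f)
    ·-assoc a b f = coeffwise λ k →
      trans (coeff-· (a * b) f k)
        (trans (*-assoc a b _)
          (trans (*-congˡ (sym (coeff-· b f k))) (sym (coeff-· a (b · f) k))))

    0· : ∀ f → 0# · f ≈ₚ []
    0· f = coeffwise λ k → trans (coeff-· 0# f k) (zeroˡ _)

    1· : ∀ f → 1# · f ≈ₚ f
    1· f = coeffwise λ k → trans (coeff-· 1# f k) (*-identityˡ _)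

    *ₚ-congˡ : ∀ f {g g′} → g ≈ₚ g′ → f *ₚ g ≈ₚ f *ₚ g′
    *ₚ-congˡ []      p = P.refl
    *ₚ-congˡ (a ∷ f) p = +ₚ-cong (·-cong refl p) (∷-cong refl (*ₚ-congˡ f p))

    *ₚ-zeroʳ : ∀ f → f *ₚ [] ≈ₚ []
    *ₚ-zeroʳ []      = P.refl
    *ₚ-zeroʳ (a ∷ f) = P.trans (∷-cong refl (*ₚ-zeroʳ f)) 0∷[]

    *ₚ-∷ : ∀ f b g → f *ₚ (b ∷ g) ≈ₚ b · f +ₚ (0# ∷ f *ₚ g)
    *ₚ-∷ []      b g = P.sym 0∷[]
    *ₚ-∷ (a ∷ f) b g = ∷-cong (+-congʳ (*-comm a b)) (begin
      a · g +ₚ f *ₚ (b ∷ g)              ≈⟨ +ₚ-cong P.refl (*ₚ-∷ f b g) ⟩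
      a · g +ₚ (b · f +ₚ (0# ∷ f *ₚ g))  ≈⟨ x∙yz≈y∙xz (a · g) (b · f) _ ⟩
      b · f +ₚ (a · g +ₚ (0# ∷ f *ₚ g))  ∎)

    *ₚ-comm : ∀ f g → f *ₚ g ≈ₚ g *ₚ f
    *ₚ-comm []      g = P.sym (*ₚ-zeroʳ g)
    *ₚ-comm (a ∷ f) g = begin
      a · g +ₚ (0# ∷ f *ₚ g)  ≈⟨ +ₚ-cong P.refl (∷-cong refl (*ₚ-comm f g)) ⟩
      a · g +ₚ (0# ∷ g *ₚ f)  ≈⟨ *ₚ-∷ g a f ⟨
      g *ₚ (a ∷ f)            ∎

    *ₚ-cong : ∀ {f f′ g g′} → f ≈ₚ f′ → g ≈ₚ g′ → f *ₚ g ≈ₚ f′ *ₚ g′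
    *ₚ-cong {f} {f′} {g} {g′} p q = begin
      f *ₚ g    ≈⟨ *ₚ-congˡ f q ⟩
      f *ₚ g′   ≈⟨ *ₚ-comm f g′ ⟩
      g′ *ₚ f   ≈⟨ *ₚ-congˡ g′ p ⟩
      g′ *ₚ f′  ≈⟨ *ₚ-comm g′ f′ ⟩
      f′ *ₚ g′  ∎

    *ₚ-distribˡ : ∀ f g h → f *ₚ (g +ₚ h) ≈ₚ f *ₚ g +ₚ f *ₚ h
    *ₚ-distribˡ []      g h = P.refl
    *ₚ-distribˡ (a ∷ f) g h = begin
      a · (g +ₚ h) +ₚ (0# ∷ f *ₚ (g +ₚ h))
        ≈⟨ +ₚ-cong (·-distribˡ a g h) (∷-cong refl (*ₚ-distribˡ f g h)) ⟩
      (a · g +ₚ a · h) +ₚ (0# ∷ f *ₚ g +ₚ f *ₚ h)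
        ≈⟨ +ₚ-cong P.refl (0∷-+ (f *ₚ g) (f *ₚ h)) ⟩
      (a · g +ₚ a · h) +ₚ ((0# ∷ f *ₚ g) +ₚ (0# ∷ f *ₚ h))
        ≈⟨ interchange (a · g) (a · h) _ _ ⟩
      (a · g +ₚ (0# ∷ f *ₚ g)) +ₚ (a · h +ₚ (0# ∷ f *ₚ h))
        ∎

    *ₚ-distribʳ : ∀ f g h → (g +ₚ h) *ₚ f ≈ₚ g *ₚ f +ₚ h *ₚ f
    *ₚ-distribʳ f g h = begin
      (g +ₚ h) *ₚ f     ≈⟨ *ₚ-comm (g +ₚ h) f ⟩
      f *ₚ (g +ₚ h)     ≈⟨ *ₚ-distribˡ f g h ⟩
      f *ₚ g +ₚ f *ₚ h  ≈⟨ +ₚ-cong (*ₚ-comm f g) (*ₚ-comm f h) ⟩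
      g *ₚ f +ₚ h *ₚ f  ∎

    0∷-* : ∀ f g → (0# ∷ f) *ₚ g ≈ₚ 0# ∷ f *ₚ g
    0∷-* f g = +ₚ-cong (0· g) P.refl

    ·-* : ∀ a f g → (a · f) *ₚ g ≈ₚ a · (f *ₚ g)
    ·-* a []      g = P.refl
    ·-* a (b ∷ f) g = begin
      (a * b) · g +ₚ (0# ∷ (a · f) *ₚ g)
        ≈⟨ +ₚ-cong (·-assoc a b g) (∷-cong (sym (zeroʳ a)) (·-* a f g)) ⟩
      a · (b · g) +ₚ a · (0# ∷ f *ₚ g)
        ≈⟨ ·-distribˡ a (b · g) (0# ∷ f *ₚ g) ⟨
      a · (b · g +ₚ (0# ∷ f *ₚ g))
        ∎

    *ₚ-assoc : ∀ f g h → (f *ₚ g) *ₚ h ≈ₚ f *ₚ (g *ₚ h)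
    *ₚ-assoc []      g h = P.refl
    *ₚ-assoc (a ∷ f) g h = begin
      (a · g +ₚ (0# ∷ f *ₚ g)) *ₚ h
        ≈⟨ *ₚ-distribʳ h (a · g) (0# ∷ f *ₚ g) ⟩
      (a · g) *ₚ h +ₚ (0# ∷ f *ₚ g) *ₚ h
        ≈⟨ +ₚ-cong (·-* a g h) (0∷-* (f *ₚ g) h) ⟩
      a · (g *ₚ h) +ₚ (0# ∷ (f *ₚ g) *ₚ h)
        ≈⟨ +ₚ-cong P.refl (∷-cong refl (*ₚ-assoc f g h)) ⟩
      a · (g *ₚ h) +ₚ (0# ∷ f *ₚ (g *ₚ h))
        ∎

    *ₚ-identityˡ : ∀ f → constₚ 1# *ₚ f ≈ₚ f
    *ₚ-identityˡ f = begin
      1# · f +ₚ (0# ∷ [])  ≈⟨ +ₚ-cong (1· f) 0∷[] ⟩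
      f +ₚ []              ≈⟨ +ₚ-identityʳ f ⟩
      f                    ∎

  commutativeRing : CommutativeRing c ℓ
  commutativeRing = record
    { Carrier = Poly
    ; _≈_     = _≈ₚ_
    ; _+_     = _+ₚ_
    ; _*_     = _*ₚ_
    ; -_      = -ₚ_
    ; 0#      = []
    ; 1#      = constₚ 1#
    ; isCommutativeRing = record
      { isRing = record
        { +-isAbelianGroup = +ₚ.isAbelianGroup
        ; *-cong           = *ₚ-cong
        ; *-assoc          = *ₚ-assoc
        ; *-identity       = *ₚ-identityˡ
                           , λ f → P.trans (*ₚ-comm f (constₚ 1#)) (*ₚ-identityˡ f)
        ; distrib          = *ₚ-distribˡ , *ₚ-distribʳ
        }
      ; *-comm = *ₚ-comm
      }
    }

module _ {c ℓ : Level} (R : CommutativeRing c ℓ) where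
  open CommutativeRing R

  ∑ : ∀ {a} {A : Set a} → List A → (A → Carrier) → Carrier
  ∑ xs f = foldr (λ a r → f a + r) 0# xs

ℤ/_ : ℕ → CommutativeRing 0ℓ 0ℓ
ℤ/ m = ℤ.+-*-commutativeRing /⟨ + m ⟩

infix 4 _≡_[mod_]
_≡_[mod_] : ℤ → ℤ → ℕ → Set
i ≡ j [mod m ] = CommutativeRing._≈_ (ℤ/ m) i j

φ : ℕ → ℕ
φ n = length (filter (coprime? n) (applyUpTo suc n))

-- IsOrder m k d expresses that ord_m(k) exists and equals d.
record IsOrder (m k d : ℕ) : Set where
  field
    positive : 1 ≤ d
    power≡1  : + (k ℕ.^ d) ≡ + 1 [mod m ]
    minimal  : ∀ {e} → 1 ≤ e → + (k ℕ.^ e) ≡ + 1 [mod m ] → d ≤ e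

-- The l-cyclotomic coset modulo n of γ; α : Fin n stands for the residue class
-- of toℕ α.
Coset : (l n : ℕ) → ℤ → Pred (Fin n) 0ℓ
Coset l n γ α = ∃ λ r → + toℕ α ≡ γ ℤ.* + (l ℕ.^ r) [mod n ]

module _ (l n : ℕ) (γ : ℤ) where
  private
    term : ℕ → ℤ
    term r = γ ℤ.* + (l ℕ.^ r)

    module M = CommutativeRing (ℤ/ n)
    open Divisibility (CommutativeRing.semiring ℤ.+-*-commutativeRing) using (_,_)

    mod? : ∀ i j → Dec (i ≡ j [mod n ])
    mod? i j = map′ (λ { (ℤ.divides q eq) → Quotient.congruent (q , ≡.sym eq) })
                    (λ { (Quotient.congruent (q , eq)) → ℤ.divides q (≡.sym eq) })
                    (+ n ℤ.∣? (i ℤ.- j))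

    ≡⇒mod : ∀ {i j} → i ≡ j → i ≡ j [mod n ]
    ≡⇒mod = M.reflexive

    term-+ : ∀ r e → term (r ℕ.+ e) ≡ term r ℤ.* + (l ℕ.^ e)
    term-+ r e = ≡.trans
      (≡.cong (γ ℤ.*_) (≡.trans (≡.cong +_ (ℕ.^-distribˡ-+-* l r e)) (ℤ.pos-* (l ℕ.^ r) (l ℕ.^ e))))
      (≡.sym (ℤ.*-assoc γ _ _))

    term-shift : ∀ {i j} e → term i ≡ term j [mod n ] → term (i ℕ.+ e) ≡ term (j ℕ.+ e) [mod n ]
    term-shift {i} {j} e i~j = M.trans (≡⇒mod (term-+ i e))
      (M.trans (M.*-congʳ i~j) (M.sym (≡⇒mod (term-+ j e))))

    mod-residue : .{{_ : ℕ.NonZero n}} → ∀ i → i ≡ + (i %ℕ n) [mod n ]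
    mod-residue i = Quotient.congruent ((i /ℕ n) , ≡.trans
      (≡.sym (xyx⁻¹≈y r ((i /ℕ n) ℤ.* + n)))
      (≡.cong (ℤ._- r) (≡.sym (ℤ.a≡a%ℕn+[a/ℕn]*n i n))))
      where
      open AbelianGroupProperties ℤ.+-0-abelianGroup using (xyx⁻¹≈y)
      r = + (i %ℕ n)

    residue : .{{_ : ℕ.NonZero n}} → Fin (suc n) → Fin n
    residue r = fromℕ< (ℤ.n%ℕd<d (term (toℕ r)) n)

    repeat : .{{_ : ℕ.NonZero n}} → ∃ λ i → ∃ λ j → i < j × j ≤ n × term i ≡ term j [mod n ]
    repeat with i , j , i<j , eq ← Fin.pigeonhole (ℕ.n<1+n n) residue
      = toℕ i , toℕ j , i<j , ℕ.s≤s⁻¹ (Fin.toℕ<n j) ,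
        M.trans (mod-residue (term (toℕ i)))
          (M.trans (≡⇒mod (≡.cong +_ same)) (M.sym (mod-residue (term (toℕ j)))))
      where
      same = ≡.trans (≡.sym (Fin.toℕ-fromℕ< _)) (≡.trans (≡.cong toℕ eq) (Fin.toℕ-fromℕ< _))

    early : .{{_ : ℕ.NonZero n}} → ∀ r → ∃ λ r′ → r′ < n × term r ≡ term r′ [mod n ]
    early = <-rec _ step
      where
      step : ∀ r → (∀ {u} → u < r → ∃ λ r′ → r′ < n × term u ≡ term r′ [mod n ]) →
             ∃ λ r′ → r′ < n × term r ≡ term r′ [mod n ]
      step r rec with r ℕ.<? n
      ... | yes r<n = r , r<n , M.refl
      ... | no  r≮n
        with i , j , i<j , j≤n , i~j ← repeat
        with r′ , r′<n , u~r′ ← rec {i ℕ.+ (r ℕ.∸ j)} (≡.subst (i ℕ.+ (r ℕ.∸ j) <_)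
               (ℕ.m+[n∸m]≡n (ℕ.≤-trans j≤n (ℕ.≮⇒≥ r≮n))) (ℕ.+-monoˡ-< (r ℕ.∸ j) i<j))
        = r′ , r′<n , M.trans (≡⇒mod (≡.cong term (≡.sym (ℕ.m+[n∸m]≡n (ℕ.≤-trans j≤n (ℕ.≮⇒≥ r≮n))))))
            (M.trans (M.sym (term-shift {i} {j} (r ℕ.∸ j) i~j)) u~r′)

  -- By pigeonhole, the exponents r < n already exhaust the coset.
  coset? : Decidable (Coset l n γ)
  coset? α = map′
    (λ { (r , eq) → toℕ r , eq })
    (λ { (r , eq) → let r′ , r′<n , eq′ = early {{Fin.nonZeroIndex α}} r in
           fromℕ< r′<n , M.trans eq (M.trans eq′ (≡⇒mod (≡.cong term (≡.sym (Fin.toℕ-fromℕ< r′<n))))) })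
    (Fin.any? λ r → mod? (+ toℕ α) (term (toℕ r)))

  coset : List (Fin n)
  coset = filter coset? (allFin n)

-- 𝔽ₗ is ℤ/ l, a field for prime l. Its elements are represented by integers, so
-- ⟦ k ⟧ is the constant k read in 𝔽ₗ.
module CyclicRing (l n : ℕ) where
  private
    module 𝔽ₗ[x] where
      open Polynomial (ℤ/ l) public
      open CommutativeRing commutativeRing public
      open Exp semiring public

  𝔽ₗ[x]/⟨xⁿ-1⟩ : CommutativeRing 0ℓ 0ℓ
  𝔽ₗ[x]/⟨xⁿ-1⟩ = 𝔽ₗ[x].commutativeRing /⟨ 𝔽ₗ[x].X 𝔽ₗ[x].^ n 𝔽ₗ[x].- 𝔽ₗ[x].1# ⟩

  open CommutativeRing 𝔽ₗ[x]/⟨xⁿ-1⟩ using (Carrier; semiring)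
  open Exp semiring using (_^_)

  ⟦_⟧ : ℤ → Carrier
  ⟦ k ⟧ = 𝔽ₗ[x].constₚ k

  x : Carrier
  x = 𝔽ₗ[x].X

  cosetSum : ℤ → Carrier
  cosetSum γ = ∑ 𝔽ₗ[x]/⟨xⁿ-1⟩ (coset l n γ) λ α → x ^ toℕ α

{-# OPTIONS --safe #-}
module Submission where

-- Write P = p^s and n = P q^t. Since l is a primitive root modulo q^t, C_{sj} is
-- the set of multiples of P q^j that are not multiples of P q^{j+1} (for j = t,
-- just {0}). Hence χ_{sj} = T_j − T_{j+1} for j < t and χ_{st} = T_t, where T_m is
-- the sum of x^k over the k < n divisible by P q^m, i.e. the geometric sum of
-- q^{t−m} powers of x^{P q^m}. Each x^{P q^k} with k ≥ m fixes T_m because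
-- x^n = 1, so T_k T_m = q^{t−k} T_m. Expanding (T_j − T_{j+1})² with these rules
-- and telescoping T_{j+1} into the χ_{sm} with m > j gives the formula.

open import Defs
open import Algebra.Bundles using (CommutativeRing)
open import Algebra.Morphism.Structures using (module RingMorphisms)
import Algebra.Morphism.Construct.Identity as Identity
open import Data.Bool.Base using (true; false; if_then_else_)
open import Data.Fin.Base as Fin using (Fin; toℕ)
import Data.Fin.Properties as Fin
open import Data.Integer.Base as ℤ using (ℤ; +_)
import Data.Integer.Divisibility.Signed as ℤ
import Data.Integer.Properties as ℤ
open import Data.Integer.Tactic.RingSolver using (solve-∀)
open import Data.List.Base using (List; []; _∷_; filter; upTo; applyUpTo; tabulate; allFin; length; lookup)
open import Data.List.Membership.Propositional using (_∈_)
open import Data.List.Membership.Propositional.Properties using (∈-applyUpTo⁺; ∈-filter⁺)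
open import Data.List.Relation.Unary.Any using (index)
open import Data.List.Relation.Unary.Any.Properties using (lookup-index)
open import Data.Nat.Base as ℕ using (ℕ; zero; suc; _≤_; _<_; _∸_; _^_; _/_; _%_; NonZero)
open import Data.Nat.Coprimality as Coprime using (Coprime; coprime?)
open import Data.Nat.Divisibility
open import Data.Nat.DivMod using (m≡m%n+[m/n]*n; m%n<n)
open import Data.Nat.GCD using (gcd)
open import Data.Nat.Primality using (Prime; prime⇒irreducible; prime⇒nonZero; prime⇒nonTrivial; euclidsLemma)
import Data.Nat.Properties as ℕ
open import Data.Nat.Properties using (_<?_)
open import Data.Product.Base using (∃; _×_; _,_; proj₁; proj₂)
open import Data.Sum.Base using (inj₁; inj₂; [_,_]′)
open import Data.Unit.Base using (tt)
open import Function.Base using (_∘_; id)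
open import Relation.Binary.PropositionalEquality as ≡ using (_≡_; _≢_; subst; cong; cong₂)
open import Relation.Nullary using (Dec; yes; no; does; ¬_; contradiction)
open import Relation.Unary using (Pred; Decidable)
import Algebra.Properties.CommutativeSemigroup as CommutativeSemigroupProperties
import Algebra.Properties.Ring as RingProperties
import Algebra.Properties.Semiring.Divisibility as SemiringDivisibility
import Algebra.Properties.Semiring.Exp as Exp
import Relation.Binary.Reasoning.Setoid as ≈-Reasoning

-- Finite sums, indicators and geometric sums over a commutative ring.

module Sums {c ℓ} (R : CommutativeRing c ℓ) where
  open CommutativeRing R
  open Exp semiring using (^-homo-*) renaming (_^_ to _^ᴿ_)
  open CommutativeSemigroupProperties +-commutativeSemigroup using (interchange)
  open RingProperties ring using (+-cancelˡ)
  open ≈-Reasoning setoid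

  infix 5 _when_
  -- Branching on `does P?` alone, as `filter` does, lets one `with` in `∑-filter` reduce both
  -- sides.
  _when_ : ∀ {p} {P : Set p} → Carrier → Dec P → Carrier
  a when P? = if does P? then a else 0#

  module _ {p} {P : Set p} {a : Carrier} where
    when-yes : (P? : Dec P) → P → a when P? ≈ a
    when-yes (yes _) _ = refl
    when-yes (no ¬p) p = contradiction p ¬p

    when-no : (P? : Dec P) → ¬ P → a when P? ≈ 0#
    when-no (yes p) ¬p = contradiction p ¬p
    when-no (no _)  _  = refl

    when-congˡ : ∀ {b} (P? : Dec P) → a ≈ b → a when P? ≈ b when P?
    when-congˡ (yes _) a≈b = a≈b
    when-congˡ (no _)  _   = refl

    *-when : ∀ b (P? : Dec P) → b * a when P? ≈ b * (a when P?)
    *-when b (yes _) = refl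
    *-when b (no _)  = sym (zeroʳ b)

  when-⇔ : ∀ {p q a} {P : Set p} {Q : Set q} (P? : Dec P) (Q? : Dec Q) →
           (P → Q) → (Q → P) → a when P? ≈ a when Q?
  when-⇔ (yes p) Q? P⇒Q Q⇒P = sym (when-yes Q? (P⇒Q p))
  when-⇔ (no ¬p) Q? P⇒Q Q⇒P = sym (when-no Q? (¬p ∘ Q⇒P))

  -- Serves to split an index set into two disjoint parts. Covering is phrased as `S → ¬ Q → P`
  -- because coset membership will be derived from the failure of a divisibility.
  when-⊎ : ∀ {p q r a} {P : Set p} {Q : Set q} {S : Set r} (P? : Dec P) (Q? : Dec Q) (S? : Dec S) →
           (S → ¬ Q → P) → (P → S) → (Q → S) → (P → ¬ Q) →
           (a when P?) + (a when Q?) ≈ a when S?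
  when-⊎ (yes p) (yes q) S? split P⇒S Q⇒S P⇒¬Q = contradiction q (P⇒¬Q p)
  when-⊎ (yes p) (no _)  S? split P⇒S Q⇒S P⇒¬Q = trans (+-identityʳ _) (sym (when-yes S? (P⇒S p)))
  when-⊎ (no _)  (yes q) S? split P⇒S Q⇒S P⇒¬Q = trans (+-identityˡ _) (sym (when-yes S? (Q⇒S q)))
  when-⊎ (no ¬p) (no ¬q) S? split P⇒S Q⇒S P⇒¬Q =
    trans (+-identityˡ _) (sym (when-no S? λ s → ¬p (split s ¬q)))

  module _ {a} {A : Set a} where
    ∑-cong : ∀ (xs : List A) {f g} → (∀ x → f x ≈ g x) → ∑ R xs f ≈ ∑ R xs g
    ∑-cong []       f≈g = refl
    ∑-cong (x ∷ xs) f≈g = +-cong (f≈g x) (∑-cong xs f≈g)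

    ∑-+ : ∀ (xs : List A) f g → ∑ R xs f + ∑ R xs g ≈ ∑ R xs (λ x → f x + g x)
    ∑-+ []       f g = +-identityˡ 0#
    ∑-+ (x ∷ xs) f g = trans (interchange _ _ _ _) (+-congˡ (∑-+ xs f g))

    ∑-filter : ∀ {p} {P : Pred A p} (P? : Decidable P) xs f →
               ∑ R (filter P? xs) f ≈ ∑ R xs (λ x → f x when P? x)
    ∑-filter P? []       f = refl
    ∑-filter P? (x ∷ xs) f with does (P? x)
    ... | true  = +-congˡ (∑-filter P? xs f)
    ... | false = trans (∑-filter P? xs f) (sym (+-identityˡ _))

  ∑< : ℕ → (ℕ → Carrier) → Carrier
  ∑< zero    f = 0#
  ∑< (suc n) f = f 0 + ∑< n (f ∘ suc)

  ∑<-cong : ∀ n {f g} → (∀ {k} → k < n → f k ≈ g k) → ∑< n f ≈ ∑< n g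
  ∑<-cong zero    f≈g = refl
  ∑<-cong (suc n) f≈g = +-cong (f≈g ℕ.z<s) (∑<-cong n (f≈g ∘ ℕ.s<s))

  ∑<-zero : ∀ n {f} → (∀ {k} → k < n → f k ≈ 0#) → ∑< n f ≈ 0#
  ∑<-zero zero    f≈0 = refl
  ∑<-zero (suc n) f≈0 = trans (+-cong (f≈0 ℕ.z<s) (∑<-zero n (f≈0 ∘ ℕ.s<s))) (+-identityˡ 0#)

  ∑<-split : ∀ m n f → ∑< (m ℕ.+ n) f ≈ ∑< m f + ∑< n (f ∘ (m ℕ.+_))
  ∑<-split zero    n f = sym (+-identityˡ _)
  ∑<-split (suc m) n f = trans (+-congˡ (∑<-split m n (f ∘ suc))) (sym (+-assoc _ _ _))

  ∑<-*ˡ : ∀ a n f → ∑< n (λ k → a * f k) ≈ a * ∑< n f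
  ∑<-*ˡ a zero    f = sym (zeroʳ a)
  ∑<-*ˡ a (suc n) f = trans (+-congˡ (∑<-*ˡ a n (f ∘ suc))) (sym (distribˡ a _ _))

  -- Adding `f 0` to the shifted sum gives the sum over `suc n` indices; splitting off its last term
  -- `f n ≈ f 0` instead leaves the unshifted sum, so `f 0` cancels.
  ∑<-rotate : ∀ n f → f n ≈ f 0 → ∑< n (f ∘ suc) ≈ ∑< n f
  ∑<-rotate n f fn≈f0 = +-cancelˡ (f 0) _ _ (begin
    ∑< (suc n) f                 ≡⟨ cong (λ m → ∑< m f) (ℕ.+-comm 1 n) ⟩
    ∑< (n ℕ.+ 1) f               ≈⟨ ∑<-split n 1 f ⟩
    ∑< n f + (f (n ℕ.+ 0) + 0#)  ≈⟨ +-congˡ (+-identityʳ _) ⟩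
    ∑< n f + f (n ℕ.+ 0)         ≡⟨ cong (λ m → ∑< n f + f m) (ℕ.+-identityʳ n) ⟩
    ∑< n f + f n                 ≈⟨ +-congˡ fn≈f0 ⟩
    ∑< n f + f 0                 ≈⟨ +-comm _ _ ⟩
    f 0 + ∑< n f                 ∎)

  ∑-applyUpTo : ∀ {a} {A : Set a} (h : ℕ → A) n f → ∑ R (applyUpTo h n) f ≈ ∑< n (f ∘ h)
  ∑-applyUpTo h zero    f = refl
  ∑-applyUpTo h (suc n) f = +-congˡ (∑-applyUpTo (h ∘ suc) n f)

  -- The hypothesis `step` says that `f m` is `g m - g (suc m)` without subtracting. Induction is on
  -- the number `k` of steps from `m` to `t`, with `m` free to move up.
  telescope : ∀ f g {t} → (∀ {m} → m < t → f m + g (suc m) ≈ g m) → f t ≈ g t →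
              ∀ k m → m ℕ.+ k ≡ t → ∑< (suc k) (f ∘ (m ℕ.+_)) ≈ g m
  telescope f g {t} step last zero m m+0≡t = begin
    f (m ℕ.+ 0) + 0#  ≈⟨ +-identityʳ _ ⟩
    f (m ℕ.+ 0)       ≡⟨ cong f m+0≡t ⟩
    f t               ≈⟨ last ⟩
    g t               ≡⟨ cong g (≡.trans (≡.sym m+0≡t) (ℕ.+-identityʳ m)) ⟩
    g m               ∎
  telescope f g step last (suc k) m m+1+k≡t = begin
    f (m ℕ.+ 0) + ∑< (suc k) (λ i → f (m ℕ.+ suc i))
      ≈⟨ +-cong (reflexive (cong f (ℕ.+-identityʳ m)))
                (∑<-cong (suc k) λ {i} _ → reflexive (cong f (ℕ.+-suc m i))) ⟩
    f m + ∑< (suc k) (f ∘ (suc m ℕ.+_))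
      ≈⟨ +-congˡ (telescope f g step last k (suc m) (≡.trans (≡.sym (ℕ.+-suc m k)) m+1+k≡t)) ⟩
    f m + g (suc m)
      ≈⟨ step (subst (m <_) m+1+k≡t (ℕ.m<m+n m ℕ.z<s)) ⟩
    g m
      ∎

  ∑-above : ∀ f {j t} → j < t →
            ∑ R (filter (j <?_) (upTo (suc t))) f ≈ ∑< (suc (t ∸ suc j)) (f ∘ (suc j ℕ.+_))
  ∑-above f {j} {t} j<t = begin
    ∑ R (filter (j <?_) (upTo (suc t))) f
      ≈⟨ ∑-filter (j <?_) (upTo (suc t)) f ⟩
    ∑ R (upTo (suc t)) g
      ≈⟨ ∑-applyUpTo id (suc t) g ⟩
    ∑< (suc t) g
      ≡⟨ cong (λ n → ∑< n g) (≡.trans (ℕ.+-suc (suc j) k) (cong suc (ℕ.m+[n∸m]≡n j<t))) ⟨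
    ∑< (suc j ℕ.+ suc k) g
      ≈⟨ ∑<-split (suc j) (suc k) g ⟩
    ∑< (suc j) g + ∑< (suc k) (g ∘ (suc j ℕ.+_))
      ≈⟨ +-cong (∑<-zero (suc j) {g} λ {i} i≤j → when-no {a = f i} (j <? i) (ℕ.≤⇒≯ (ℕ.s≤s⁻¹ i≤j)))
                (∑<-cong (suc k) {g ∘ (suc j ℕ.+_)} {f ∘ (suc j ℕ.+_)} λ {i} _ →
                  when-yes (j <? (suc j ℕ.+ i)) (ℕ.m≤m+n (suc j) i)) ⟩
    0# + ∑< (suc k) (f ∘ (suc j ℕ.+_))
      ≈⟨ +-identityˡ _ ⟩
    ∑< (suc k) (f ∘ (suc j ℕ.+_))
      ∎
    where
    k = t ∸ suc j
    g = λ m → f m when (j <? m)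

  ∑-tabulate : ∀ {a} {A : Set a} n (h : Fin n → A) f g → (∀ i → f (h i) ≈ g (toℕ i)) →
               ∑ R (tabulate h) f ≈ ∑< n g
  ∑-tabulate zero    h f g fh≈g = refl
  ∑-tabulate (suc n) h f g fh≈g =
    +-cong (fh≈g Fin.zero) (∑-tabulate n (h ∘ Fin.suc) f (g ∘ suc) (fh≈g ∘ Fin.suc))

  -- 1 + z + ... + z^(n-1) in Horner form, so that cutting off the first block of a sum matches one
  -- unfolding.
  geom : Carrier → ℕ → Carrier
  geom z zero    = 0#
  geom z (suc n) = 1# + z * geom z n

  geom-step : ∀ z n → 1# + z * geom z n ≈ geom z n + z ^ᴿ n
  geom-step z zero    = trans (+-congˡ (zeroʳ z)) (+-comm _ _)
  geom-step z (suc n) = begin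
    1# + z * (1# + z * geom z n)      ≈⟨ +-congˡ (*-congˡ (geom-step z n)) ⟩
    1# + z * (geom z n + z ^ᴿ n)      ≈⟨ +-congˡ (distribˡ z _ _) ⟩
    1# + (z * geom z n + z * z ^ᴿ n)  ≈⟨ +-assoc _ _ _ ⟨
    1# + z * geom z n + z * z ^ᴿ n    ∎

  -- By `geom-step`, adding `1#` to the left side gives `geom z n + z ^ᴿ n`, which is
  -- `geom z n + 1#`.
  geom-fixed : ∀ z n → z ^ᴿ n ≈ 1# → z * geom z n ≈ geom z n
  geom-fixed z n zⁿ≈1 = +-cancelˡ 1# _ _
    (trans (geom-step z n) (trans (+-congˡ zⁿ≈1) (+-comm _ _)))

  ^-fixed : ∀ {z g} i → z * g ≈ g → z ^ᴿ i * g ≈ g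
  ^-fixed zero    zg≈g = *-identityˡ _
  ^-fixed (suc i) zg≈g = trans (*-assoc _ _ _) (trans (*-congˡ (^-fixed i zg≈g)) zg≈g)

  -- Cut the range into `N` blocks of length `d`. In the first block only index 0 is a multiple of
  -- `d`, and shifting the index by `d` multiplies the terms by `x ^ᴿ d`.
  ∑<-multiples : ∀ d .{{_ : NonZero d}} N x →
                 ∑< (N ℕ.* d) (λ k → x ^ᴿ k when (d ∣? k)) ≈ geom (x ^ᴿ d) N
  ∑<-multiples d zero    x = refl
  ∑<-multiples d@(suc d-1) (suc N) x = begin
    ∑< (d ℕ.+ N ℕ.* d) g                       ≈⟨ ∑<-split d (N ℕ.* d) g ⟩
    ∑< d g + ∑< (N ℕ.* d) (g ∘ (d ℕ.+_))       ≈⟨ +-cong first (∑<-cong (N ℕ.* d) λ _ → shift _) ⟩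
    1# + ∑< (N ℕ.* d) (λ k → x ^ᴿ d * g k)     ≈⟨ +-congˡ (∑<-*ˡ (x ^ᴿ d) (N ℕ.* d) g) ⟩
    1# + x ^ᴿ d * ∑< (N ℕ.* d) g               ≈⟨ +-congˡ (*-congˡ (∑<-multiples d N x)) ⟩
    1# + x ^ᴿ d * geom (x ^ᴿ d) N              ∎
    where
    g = λ k → x ^ᴿ k when (d ∣? k)

    first : ∑< d g ≈ 1#
    first = trans (+-cong (when-yes (d ∣? 0) (d ∣0))
                          (∑<-zero d-1 λ {k} k<d-1 → when-no (d ∣? suc k) (>⇒∤ (ℕ.s<s k<d-1))))
                  (+-identityʳ 1#)

    shift : ∀ k → g (d ℕ.+ k) ≈ x ^ᴿ d * g k
    shift k = begin
      x ^ᴿ (d ℕ.+ k) when (d ∣? (d ℕ.+ k))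
        ≈⟨ when-⇔ (d ∣? (d ℕ.+ k)) (d ∣? k) (λ d∣ → ∣m+n∣m⇒∣n d∣ ∣-refl) (∣m∣n⇒∣m+n ∣-refl) ⟩
      x ^ᴿ (d ℕ.+ k) when (d ∣? k)
        ≈⟨ when-congˡ (d ∣? k) (^-homo-* x d k) ⟩
      x ^ᴿ d * x ^ᴿ k when (d ∣? k)
        ≈⟨ *-when (x ^ᴿ d) (d ∣? k) ⟩
      x ^ᴿ d * (x ^ᴿ k when (d ∣? k))
        ∎

  module _ {ι : ℤ → Carrier}
           (ι-homo : RingMorphisms.IsRingHomomorphism ℤ.+-*-rawRing rawRing ι) where
    open RingMorphisms.IsRingHomomorphism ι-homo

    -- Each of the `n` powers of `w` in `geom w n` fixes `g`, so together they act as the integer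
    -- `n`. An abstract `ι` covers both the constants of the quotient ring and ℤ itself.
    geom-absorb : ∀ {w g} n → w * g ≈ g → geom w n * g ≈ ι (+ n) * g
    geom-absorb {w} {g} zero    wg≈g = *-congʳ (sym 0#-homo)
    geom-absorb {w} {g} (suc n) wg≈g = begin
      (1# + w * geom w n) * g      ≈⟨ distribʳ g _ _ ⟩
      1# * g + w * geom w n * g    ≈⟨ +-congˡ (*-assoc w _ g) ⟩
      1# * g + w * (geom w n * g)  ≈⟨ +-congˡ (*-congˡ (geom-absorb n wg≈g)) ⟩
      1# * g + w * (ι (+ n) * g)   ≈⟨ +-congˡ (x∙yz≈y∙xz w (ι (+ n)) g) ⟩
      1# * g + ι (+ n) * (w * g)   ≈⟨ +-cong (*-congʳ (sym 1#-homo)) (*-congˡ wg≈g) ⟩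
      ι (+ 1) * g + ι (+ n) * g    ≈⟨ distribʳ g _ _ ⟨
      (ι (+ 1) + ι (+ n)) * g      ≈⟨ *-congʳ (+-homo (+ 1) (+ n)) ⟨
      ι (+ suc n) * g              ∎
      where open CommutativeSemigroupProperties *-commutativeSemigroup using (x∙yz≈y∙xz)

    ∑-1 : ∀ {a} {A : Set a} (xs : List A) → ∑ R xs (λ _ → 1#) ≈ ι (+ length xs)
    ∑-1 []       = sym 0#-homo
    ∑-1 (x ∷ xs) = trans (+-cong (sym 1#-homo) (∑-1 xs)) (sym (+-homo (+ 1) (+ length xs)))

-- Prime powers: coprimality and Euler's function.

module _ {q : ℕ} (q-prime : Prime q) where
  private instance
    q≢0 : NonZero q
    q≢0 = prime⇒nonZero q-prime

  prime∣^⇒∣ : ∀ a r → q ∣ a ^ r → q ∣ a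
  prime∣^⇒∣ a zero    q∣1  =
    contradiction (∣1⇒≡1 q∣1) (ℕ.nonTrivial⇒≢1 {{prime⇒nonTrivial q-prime}})
  prime∣^⇒∣ a (suc r) q∣aʳ = [ id , prime∣^⇒∣ a r ]′ (euclidsLemma a (a ^ r) q-prime q∣aʳ)

  -- A common divisor of `q ^ suc k` and `a` is coprime to `q`, since otherwise `q` would divide
  -- `a`; hence it already divides `q ^ k`, and induction descends.
  ∤⇒coprime-^ : ∀ {a} k → q ∤ a → Coprime (q ^ k) a
  ∤⇒coprime-^ k q∤a = go k
    where
    go : ∀ k → Coprime (q ^ k) _
    go zero    (d∣1 , _) = ∣1⇒≡1 d∣1
    go (suc k) {d} (d∣q^k+1 , d∣a) =
      go k (Coprime.coprime-divisor {d} {q} d⊥q d∣q^k+1 , d∣a)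
      where
      d⊥q : Coprime d q
      d⊥q (e∣d , e∣q) with prime⇒irreducible q-prime e∣q
      ... | inj₁ e≡1    = e≡1
      ... | inj₂ ≡.refl = contradiction (∣-trans e∣d d∣a) q∤a

  coprime-^⇒∤ : ∀ {a} k → Coprime (q ^ suc k) a → q ∤ a
  coprime-^⇒∤ k coprime q∣a =
    ℕ.nonTrivial⇒≢1 {{prime⇒nonTrivial q-prime}} (coprime (m∣m*n (q ^ k) , q∣a))

  -- The numbers 1, ..., q^(k+1) split into those coprime to `Q` and the q^k multiples of `q`.
  -- Working in ℤ makes subtraction available and lets the general sum lemmas do the counting.
  φ-prime-power : ∀ k → + φ (q ^ suc k) ≡ (+ q ℤ.- + 1) ℤ.* + (q ^ k)
  φ-prime-power k = begin
    + φ Q                              ≡⟨ cancel (+ φ Q) (+ (q ^ k)) ⟩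
    + φ Q ℤ.+ + (q ^ k) ℤ.- + (q ^ k)  ≡⟨ cong (ℤ._- + (q ^ k)) count ⟩
    + Q ℤ.- + (q ^ k)                  ≡⟨ cong (ℤ._- + (q ^ k)) (ℤ.pos-* q (q ^ k)) ⟩
    + q ℤ.* + (q ^ k) ℤ.- + (q ^ k)    ≡⟨ factor (+ q) (+ (q ^ k)) ⟩
    (+ q ℤ.- + 1) ℤ.* + (q ^ k)        ∎
    where
    open ≡.≡-Reasoning
    open Sums ℤ.+-*-commutativeRing
    open Exp (CommutativeRing.semiring ℤ.+-*-commutativeRing) using () renaming (_^_ to _^ᶻ_)
    Q = q ^ suc k
    idℤ = Identity.isRingHomomorphism ℤ.+-*-rawRing ≡.refl

    cancel : ∀ a b → a ≡ a ℤ.+ b ℤ.- b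
    cancel = solve-∀

    factor : ∀ a b → a ℤ.* b ℤ.- b ≡ (a ℤ.- + 1) ℤ.* b
    factor = solve-∀

    1^ : ∀ n → (+ 1) ^ᶻ n ≡ + 1
    1^ zero    = ≡.refl
    1^ (suc n) = ≡.trans (ℤ.*-identityˡ _) (1^ n)

    g : ℕ → ℤ
    g i = (+ 1) ^ᶻ i when (q ∣? i)

    -- `φ` counts over 1, ..., `Q`, but `∑<` runs over 0, ..., `Q` - 1. Both 0 and `Q` are multiples
    -- of `q`, which allows the rotation.
    gQ≡g0 : g Q ≡ g 0
    gQ≡g0 = ≡.trans (when-yes (q ∣? Q) (m∣m*n (q ^ k)))
                    (≡.trans (1^ Q) (≡.sym (when-yes (q ∣? 0) (q ∣0))))

    -- At x = 1 the sum of xⁱ over the multiples i of q counts them.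
    multiples : ∑< Q (g ∘ suc) ≡ + (q ^ k)
    multiples = begin
      ∑< Q (g ∘ suc)                            ≡⟨ ∑<-rotate Q g gQ≡g0 ⟩
      ∑< Q g                                    ≡⟨ cong (λ n → ∑< n g) (ℕ.*-comm q (q ^ k)) ⟩
      ∑< (q ^ k ℕ.* q) g                        ≡⟨ ∑<-multiples q (q ^ k) (+ 1) ⟩
      geom ((+ 1) ^ᶻ q) (q ^ k)                 ≡⟨ ℤ.*-identityʳ _ ⟨
      geom ((+ 1) ^ᶻ q) (q ^ k) ℤ.* + 1         ≡⟨ geom-absorb idℤ (q ^ k) (≡.trans (ℤ.*-identityʳ _) (1^ q)) ⟩
      + (q ^ k) ℤ.* + 1                         ≡⟨ ℤ.*-identityʳ _ ⟩
      + (q ^ k)                                 ∎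

    coprimes : ℕ → ℤ
    coprimes i = + 1 when coprime? Q i

    split : ∀ i → coprimes i ℤ.+ g i ≡ + 1
    split i = ≡.trans (cong (ℤ._+_ (coprimes i)) (when-congˡ (q ∣? i) (1^ i)))
      -- `yes tt` stands for the full set, whose indicator is constantly `+ 1`.
      (when-⊎ {a = + 1} (coprime? Q i) (q ∣? i) (yes tt)
        (λ _ → ∤⇒coprime-^ (suc k)) (λ _ → tt) (λ _ → tt) (coprime-^⇒∤ k))

    range = applyUpTo suc Q

    one : ∀ n f → (∀ i → f i ≡ + 1) → ∑< n f ≡ + n
    one zero    f f≡1 = ≡.refl
    one (suc n) f f≡1 = cong₂ ℤ._+_ (f≡1 0) (one n (f ∘ suc) (f≡1 ∘ suc))

    count : + φ Q ℤ.+ + (q ^ k) ≡ + Q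
    count = begin
      + φ Q ℤ.+ + (q ^ k)
        ≡⟨ cong₂ ℤ._+_ (∑-1 idℤ (filter (coprime? Q) range)) multiples ⟨
      ∑ ℤ.+-*-commutativeRing (filter (coprime? Q) range) (λ _ → + 1) ℤ.+ ∑< Q (g ∘ suc)
        ≡⟨ cong₂ ℤ._+_ (∑-filter (coprime? Q) range _) (≡.sym (∑-applyUpTo suc Q g)) ⟩
      ∑ ℤ.+-*-commutativeRing range coprimes ℤ.+ ∑ ℤ.+-*-commutativeRing range g
        ≡⟨ ∑-+ range coprimes g ⟩
      ∑ ℤ.+-*-commutativeRing range (λ i → coprimes i ℤ.+ g i)
        ≡⟨ ∑-applyUpTo suc Q (λ i → coprimes i ℤ.+ g i) ⟩
      ∑< Q (λ i → coprimes (suc i) ℤ.+ g (suc i))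
        ≡⟨ one Q (λ i → coprimes (suc i) ℤ.+ g (suc i)) (split ∘ suc) ⟩
      + Q
        ∎

-- Congruences of integers and divisibility.

module _ {n : ℕ} {i j : ℤ} where
  open SemiringDivisibility (CommutativeRing.semiring ℤ.+-*-commutativeRing) using (_,_)

  mod⇒∣ : i ≡ j [mod n ] → + n ℤ.∣ i ℤ.- j
  mod⇒∣ (Quotient.congruent (k , eq)) = ℤ.divides k (≡.sym eq)

  ∣⇒mod : + n ℤ.∣ i ℤ.- j → i ≡ j [mod n ]
  ∣⇒mod (ℤ.divides k eq) = Quotient.congruent (k , ≡.sym eq)

mod-∣ : ∀ {d n a b} → d ∣ n → + a ≡ + b [mod n ] → d ∣ b → d ∣ a
mod-∣ {d} {n} {a} {b} d∣n a~b d∣b = ℤ.∣⇒∣ᵤ (subst (+ d ℤ.∣_) (cancel (+ a) (+ b))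
  (ℤ.∣m∣n⇒∣m+n (ℤ.∣-trans (ℤ.∣ᵤ⇒∣ d∣n) (mod⇒∣ a~b)) (ℤ.∣ᵤ⇒∣ d∣b)))
  where
  cancel : ∀ a b → a ℤ.- b ℤ.+ b ≡ a
  cancel = solve-∀

%≡%⇒mod : ∀ {a b} n .{{_ : NonZero n}} → a % n ≡ b % n → + a ≡ + b [mod n ]
%≡%⇒mod {a} {b} n eq = ∣⇒mod (ℤ.divides (+ (a / n) ℤ.- + (b / n)) (begin
  + a ℤ.- + b
    ≡⟨ cong₂ ℤ._-_ (decompose a) (≡.trans (decompose b) (cong (λ r → + r ℤ.+ + (b / n) ℤ.* + n) (≡.sym eq))) ⟩
  (+ (a % n) ℤ.+ + (a / n) ℤ.* + n) ℤ.- (+ (a % n) ℤ.+ + (b / n) ℤ.* + n)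
    ≡⟨ cancel (+ (a % n)) (+ (a / n)) (+ (b / n)) (+ n) ⟩
  (+ (a / n) ℤ.- + (b / n)) ℤ.* + n
    ∎))
  where
  open ≡.≡-Reasoning
  decompose : ∀ a → + a ≡ + (a % n) ℤ.+ + (a / n) ℤ.* + n
  decompose a = ≡.trans (cong +_ (m≡m%n+[m/n]*n a n))
                        (cong (ℤ._+_ (+ (a % n))) (ℤ.pos-* (a / n) n))
  cancel : ∀ r u v n → (r ℤ.+ u ℤ.* n) ℤ.- (r ℤ.+ v ℤ.* n) ≡ (u ℤ.- v) ℤ.* n
  cancel = solve-∀

-- Powers of a primitive root exhaust the units.

-- The d = φ Q powers of l below exponent d are distinct units, so adjoining any
-- unit u makes two of d + 1 elements of the d-element group of units coincide.
module _ {Q l : ℕ} .{{_ : NonZero Q}} (Q≢1 : Q ≢ 1) (Q⊥l : ∀ r → Coprime Q (l ^ r))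
         (order : IsOrder Q l (φ Q)) where
  private
    units = filter (coprime? Q) (applyUpTo suc Q)

    %∈units : ∀ {v} → Coprime Q v → v % Q ∈ units
    %∈units {v} Q⊥v = ∈-filter⁺ (coprime? Q) (inRange (v % Q) (m%n<n v Q) Q⊥v%Q) Q⊥v%Q
      where
      Q⊥v%Q : Coprime Q (v % Q)
      Q⊥v%Q (d∣Q , d∣v%Q) = Q⊥v (d∣Q , ∣n∣m%n⇒∣m d∣Q d∣v%Q)

      -- Residues lie in 0, ..., `Q` - 1, while `φ` counts over 1, ..., `Q`. The residue 0 cannot
      -- occur: it is coprime to `Q` only if `Q` is 1.
      inRange : ∀ r → r < Q → Coprime Q r → r ∈ applyUpTo suc Q
      inRange zero    r<Q Q⊥r = contradiction (Q⊥r (∣-refl , Q ∣0)) Q≢1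
      inRange (suc r) r<Q Q⊥r = ∈-applyUpTo⁺ suc (ℕ.<-trans (ℕ.n<1+n r) r<Q)

    -- Otherwise `Q` divides `l ^ j` - `l ^ i`, which is `l ^ i` times `l ^ e` - 1 with `e = j ∸ i`.
    -- Cancelling the unit `l ^ i` makes `l ^ e` congruent to 1 with 1 ≤ `e` < `φ Q`, against
    -- minimality of the order.
    powers-distinct : ∀ {i j} → i < j → j < φ Q → l ^ i % Q ≢ l ^ j % Q
    powers-distinct {i} {j} i<j j<d eq = ℕ.<⇒≱ (ℕ.≤-<-trans (ℕ.m∸n≤m j i) j<d)
      (IsOrder.minimal order (ℕ.m<n⇒0<n∸m i<j) (∣⇒mod (ℤ.∣ᵤ⇒∣
        (Coprime.coprime-divisor (Q⊥l i) (subst (Q ∣_) (ℤ.abs-* (+ (l ^ i)) _)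
          (ℤ.∣⇒∣ᵤ (subst (+ Q ℤ.∣_) factor (mod⇒∣ (%≡%⇒mod Q (≡.sym eq))))))))))
      where
      open ≡.≡-Reasoning
      e = j ∸ i
      distrib : ∀ a b → a ℤ.* b ℤ.- a ≡ a ℤ.* (b ℤ.- + 1)
      distrib = solve-∀
      factor : + (l ^ j) ℤ.- + (l ^ i) ≡ + (l ^ i) ℤ.* (+ (l ^ e) ℤ.- + 1)
      factor = begin
        + (l ^ j) ℤ.- + (l ^ i)
          ≡⟨ cong (λ m → + (l ^ m) ℤ.- + (l ^ i)) (ℕ.m+[n∸m]≡n (ℕ.<⇒≤ i<j)) ⟨
        + (l ^ (i ℕ.+ e)) ℤ.- + (l ^ i)
          ≡⟨ cong (λ m → + m ℤ.- + (l ^ i)) (ℕ.^-distribˡ-+-* l i e) ⟩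
        + (l ^ i ℕ.* l ^ e) ℤ.- + (l ^ i)
          ≡⟨ cong (ℤ._- + (l ^ i)) (ℤ.pos-* (l ^ i) (l ^ e)) ⟩
        + (l ^ i) ℤ.* + (l ^ e) ℤ.- + (l ^ i)
          ≡⟨ distrib (+ (l ^ i)) (+ (l ^ e)) ⟩
        + (l ^ i) ℤ.* (+ (l ^ e) ℤ.- + 1)
          ∎

  unit≡power : ∀ {u} → Coprime Q u → ∃ λ r → + u ≡ + (l ^ r) [mod Q ]
  -- The pigeonholes are the positions in `units`, a list whose length is `φ Q` by definition.
  unit≡power {u} Q⊥u = match (Fin.pigeonhole (ℕ.n<1+n (φ Q)) (λ i → index (∈units i)))
    where
    element : Fin (suc (φ Q)) → ℕ
    element Fin.zero    = u
    element (Fin.suc i) = l ^ toℕ i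

    ∈units : ∀ i → element i % Q ∈ units
    ∈units Fin.zero    = %∈units Q⊥u
    ∈units (Fin.suc i) = %∈units (Q⊥l (toℕ i))

    same : ∀ i j → index (∈units i) ≡ index (∈units j) → element i % Q ≡ element j % Q
    same i j eq = ≡.trans (lookup-index (∈units i))
      (≡.trans (cong (lookup units) eq) (≡.sym (lookup-index (∈units j))))

    match : (∃ λ i → ∃ λ j → i Fin.< j × index (∈units i) ≡ index (∈units j)) →
            ∃ λ r → + u ≡ + (l ^ r) [mod Q ]
    -- A collision with `u` yields the exponent; a collision of two powers contradicts
    -- `powers-distinct`.
    match (Fin.zero  , Fin.suc j , _         , eq) = toℕ j , %≡%⇒mod Q (same Fin.zero (Fin.suc j) eq)
    match (Fin.suc i , Fin.suc j , ℕ.s≤s i<j , eq) =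
      contradiction (same (Fin.suc i) (Fin.suc j) eq) (powers-distinct i<j (Fin.toℕ<n j))

-- Cyclotomic cosets described by divisibility.

module _ {P q t l : ℕ} .{{_ : NonZero P}} (q-prime : Prime q) (q∤l : q ∤ l) (1≤t : 1 ≤ t)
         (order : IsOrder (q ^ t) l (φ (q ^ t))) where
  private
    n = P ℕ.* q ^ t

    instance
      q≢0 : NonZero q
      q≢0 = prime⇒nonZero q-prime

    -- The representative of C_{sm}; `d t` is `n` itself.
    d : ℕ → ℕ
    d m = P ℕ.* q ^ m

    d≢0 : ∀ m → NonZero (d m)
    d≢0 m = ℕ.m*n≢0 P (q ^ m)
      where instance _ = ℕ.m^n≢0 q m

    d-suc : ∀ m → d (suc m) ≡ d m ℕ.* q
    d-suc m = ≡.trans (cong (P ℕ.*_) (ℕ.*-comm q (q ^ m))) (≡.sym (ℕ.*-assoc P (q ^ m) q))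

    d-+ : ∀ m k → q ^ k ℕ.* d m ≡ d (m ℕ.+ k)
    d-+ m k = begin
      q ^ k ℕ.* (P ℕ.* q ^ m)  ≡⟨ ℕ.*-comm (q ^ k) _ ⟩
      P ℕ.* q ^ m ℕ.* q ^ k    ≡⟨ ℕ.*-assoc P (q ^ m) (q ^ k) ⟩
      P ℕ.* (q ^ m ℕ.* q ^ k)  ≡⟨ cong (P ℕ.*_) (ℕ.^-distribˡ-+-* q m k) ⟨
      P ℕ.* q ^ (m ℕ.+ k)      ∎
      where open ≡.≡-Reasoning

    d-∸ : ∀ {m k} → m ≤ k → q ^ (k ∸ m) ℕ.* d m ≡ d k
    d-∸ {m} {k} m≤k = ≡.trans (d-+ m (k ∸ m)) (cong d (ℕ.m+[n∸m]≡n m≤k))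

    q^t≢1 : q ^ t ≢ 1
    q^t≢1 q^t≡1 = [ ℕ.m<n⇒n≢0 1≤t , ℕ.nonTrivial⇒≢1 {{prime⇒nonTrivial q-prime}} ]′
      (ℕ.m^n≡1⇒n≡0∨m≡1 q t q^t≡1)

    power-of-l : ∀ {u} → q ∤ u → ∃ λ r → + u ≡ + (l ^ r) [mod q ^ t ]
    power-of-l q∤u = unit≡power {{ℕ.m^n≢0 q t}} q^t≢1
      (λ r → ∤⇒coprime-^ q-prime t (q∤l ∘ prime∣^⇒∣ q-prime l r)) order
      (∤⇒coprime-^ q-prime t q∤u)

    module _ {m : ℕ} {α : Fin n} where
      -- `d m` divides the modulus `n` and every `d m * l ^ r`, hence everything congruent to such a
      -- term.
      coset⇒∣ : m ≤ t → Coset l n (+ d m) α → d m ∣ toℕ α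
      coset⇒∣ m≤t (r , α~) = mod-∣ (divides (q ^ (t ∸ m)) (≡.sym (d-∸ m≤t)))
        (subst (λ i → + toℕ α ≡ i [mod n ]) (≡.sym (ℤ.pos-* (d m) (l ^ r))) α~)
        (m∣m*n (l ^ r))

      -- Since `m < t`, `d (suc m)` divides `n`, so if it divided `toℕ α` it would divide
      -- `d m * l ^ r`; cancelling `d m` leaves `q ∣ l ^ r`, impossible as `q ∤ l`.
      coset⇒∤ : m < t → Coset l n (+ d m) α → d (suc m) ∤ toℕ α
      coset⇒∤ m<t (r , α~) ∣α = q∤l (prime∣^⇒∣ q-prime l r
        (*-cancelˡ-∣ (d m) {{d≢0 m}} (subst (_∣ d m ℕ.* l ^ r) (d-suc m)
          (mod-∣ (divides (q ^ (t ∸ suc m)) (≡.sym (d-∸ m<t)))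
            (CommutativeRing.sym (ℤ/ n)
              (subst (λ i → + toℕ α ≡ i [mod n ]) (≡.sym (ℤ.pos-* (d m) (l ^ r))) α~))
            ∣α))))

      -- Write `toℕ α` as `u * d m`. Then `q ∤ u`, so `u` is a power of `l` modulo `q ^ t`, and
      -- multiplying that congruence by `d m` gives one modulo `n`.
      ∣∧∤⇒coset : d m ∣ toℕ α → d (suc m) ∤ toℕ α → Coset l n (+ d m) α
      ∣∧∤⇒coset (divides u α≡u*d) ∤α = proj₁ power , scale (mod⇒∣ (proj₂ power))
        where
        q∤u : q ∤ u
        q∤u q∣u = ∤α (≡.subst₂ _∣_ (≡.trans (ℕ.*-comm q (d m)) (≡.sym (d-suc m)))
                                   (≡.sym α≡u*d) (*-monoˡ-∣ (d m) q∣u))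
        power = power-of-l q∤u
        r = proj₁ power

        scale : + (q ^ t) ℤ.∣ + u ℤ.- + (l ^ r) → + toℕ α ≡ + d m ℤ.* + (l ^ r) [mod n ]
        -- As `q ^ t * d m` equals `q ^ m * n`, the quotient `k` picks up a factor `q ^ m`.
        scale (ℤ.divides k eq) = ∣⇒mod (ℤ.divides (k ℤ.* + (q ^ m)) (begin
          + toℕ α ℤ.- + d m ℤ.* + (l ^ r)
            ≡⟨ cong (λ a → + a ℤ.- + d m ℤ.* + (l ^ r)) α≡u*d ⟩
          + (u ℕ.* d m) ℤ.- + d m ℤ.* + (l ^ r)
            ≡⟨ cong (ℤ._- + d m ℤ.* + (l ^ r)) (ℤ.pos-* u (d m)) ⟩
          + u ℤ.* + d m ℤ.- + d m ℤ.* + (l ^ r)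
            ≡⟨ factor (+ u) (+ d m) (+ (l ^ r)) ⟩
          (+ u ℤ.- + (l ^ r)) ℤ.* + d m
            ≡⟨ cong₂ ℤ._*_ eq (ℤ.pos-* P (q ^ m)) ⟩
          k ℤ.* + (q ^ t) ℤ.* (+ P ℤ.* + (q ^ m))
            ≡⟨ swap k (+ (q ^ t)) (+ P) (+ (q ^ m)) ⟩
          k ℤ.* + (q ^ m) ℤ.* (+ P ℤ.* + (q ^ t))
            ≡⟨ cong (k ℤ.* + (q ^ m) ℤ.*_) (ℤ.pos-* P (q ^ t)) ⟨
          k ℤ.* + (q ^ m) ℤ.* + n
            ∎))
          where
          open ≡.≡-Reasoning
          factor : ∀ u d a → u ℤ.* d ℤ.- d ℤ.* a ≡ (u ℤ.- a) ℤ.* d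
          factor = solve-∀
          swap : ∀ k a b c → k ℤ.* a ℤ.* (b ℤ.* c) ≡ k ℤ.* c ℤ.* (b ℤ.* a)
          swap = solve-∀

      -- For `m ≡ t` the representative is `n`, so both `toℕ α` and the term with exponent 0 vanish
      -- modulo `n`.
      coset-last : m ≡ t → d m ∣ toℕ α → Coset l n (+ d m) α
      coset-last ≡.refl d∣α = 0 , ∣⇒mod (subst (λ i → + n ℤ.∣ + toℕ α ℤ.- i)
        (≡.sym (ℤ.*-identityʳ (+ n))) (ℤ.∣m∣n⇒∣m-n {m = + toℕ α} (ℤ.∣ᵤ⇒∣ d∣α) ℤ.∣-refl))

  -- Multiplication rules and the square of a coset sum.

  module _ {a ℓ} (R : CommutativeRing a ℓ) {ι : ℤ → CommutativeRing.Carrier R}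
           (ι-homo : RingMorphisms.IsRingHomomorphism ℤ.+-*-rawRing (CommutativeRing.rawRing R) ι)
           {x : CommutativeRing.Carrier R}
           (xⁿ≈1 : CommutativeRing._≈_ R (Exp._^_ (CommutativeRing.semiring R) x (P ℕ.* q ^ t))
                                         (CommutativeRing.1# R)) where
    open CommutativeRing R
    open RingMorphisms.IsRingHomomorphism ι-homo
    open Sums R
    open Exp semiring using (^-assocʳ; ^-congʳ) renaming (_^_ to _^ᴿ_)
    open RingProperties ring using (+-cancelʳ)
    open ≈-Reasoning setoid

    private
      χ T : ℕ → Carrier
      χ m = ∑ R (coset l n (+ d m)) λ α → x ^ᴿ toℕ α
      T m = ∑< n λ k → x ^ᴿ k when (d m ∣? k)

      allFin-∑ : ∀ f → ∑ R (allFin n) (f ∘ toℕ) ≈ ∑< n f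
      allFin-∑ f = ∑-tabulate n id (f ∘ toℕ) f (λ _ → refl)

      χ-∑ : ∀ m → χ m ≈ ∑ R (allFin n) λ α → x ^ᴿ toℕ α when coset? l n (+ d m) α
      χ-∑ m = ∑-filter (coset? l n (+ d m)) (allFin n) (λ α → x ^ᴿ toℕ α)

      χ-last : χ t ≈ T t
      χ-last = begin
        χ t
          ≈⟨ χ-∑ t ⟩
        ∑ R (allFin n) (λ α → x ^ᴿ toℕ α when coset? l n (+ d t) α)
          ≈⟨ ∑-cong (allFin n) (λ α → when-⇔ (coset? l n (+ d t) α) (d t ∣? toℕ α)
               (coset⇒∣ {t} ℕ.≤-refl) (coset-last {t} ≡.refl)) ⟩
        ∑ R (allFin n) (λ α → x ^ᴿ toℕ α when (d t ∣? toℕ α))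
          ≈⟨ allFin-∑ (λ k → x ^ᴿ k when (d t ∣? k)) ⟩
        T t
          ∎

      -- The multiples of `d m` split into the coset of `d m` and the multiples of `d (suc m)`. The
      -- additive form avoids subtraction and fits `telescope`.
      χ-+ : ∀ {m} → m < t → χ m + T (suc m) ≈ T m
      χ-+ {m} m<t = begin
        χ m + T (suc m)
          ≈⟨ +-cong (χ-∑ m) (sym (allFin-∑ (g (suc m)))) ⟩
        ∑ R (allFin n) (λ α → x ^ᴿ toℕ α when coset? l n (+ d m) α) + ∑ R (allFin n) (g (suc m) ∘ toℕ)
          ≈⟨ ∑-+ (allFin n) (λ α → x ^ᴿ toℕ α when coset? l n (+ d m) α) (g (suc m) ∘ toℕ) ⟩
        ∑ R (allFin n) (λ α → (x ^ᴿ toℕ α when coset? l n (+ d m) α) + g (suc m) (toℕ α))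
          ≈⟨ ∑-cong (allFin n) (λ α → when-⊎ (coset? l n (+ d m) α) (d (suc m) ∣? toℕ α) (d m ∣? toℕ α)
               (∣∧∤⇒coset {m}) (coset⇒∣ {m} (ℕ.<⇒≤ m<t))
               (∣-trans (divides q (≡.trans (d-suc m) (ℕ.*-comm (d m) q))))
               (coset⇒∤ {m} m<t)) ⟩
        ∑ R (allFin n) (g m ∘ toℕ)
          ≈⟨ allFin-∑ (g m) ⟩
        T m
          ∎
        where
        g : ℕ → ℕ → Carrier
        g m k = x ^ᴿ k when (d m ∣? k)

      T-geom : ∀ {m} → m ≤ t → T m ≈ geom (x ^ᴿ d m) (q ^ (t ∸ m))
      T-geom {m} m≤t = begin
        ∑< n g                        ≡⟨ cong (λ n → ∑< n g) (d-∸ m≤t) ⟨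
        ∑< (q ^ (t ∸ m) ℕ.* d m) g    ≈⟨ ∑<-multiples (d m) {{d≢0 m}} (q ^ (t ∸ m)) x ⟩
        geom (x ^ᴿ d m) (q ^ (t ∸ m)) ∎
        where g = λ k → x ^ᴿ k when (d m ∣? k)

      -- `x ^ᴿ d k` is a power of `x ^ᴿ d m`, which fixes the geometric sum `T m` because its power
      -- with exponent `q ^ (t ∸ m)` is `x ^ᴿ n`, that is, 1.
      T-fixed : ∀ {m k} → m ≤ k → k ≤ t → x ^ᴿ d k * T m ≈ T m
      T-fixed {m} {k} m≤k k≤t = begin
        x ^ᴿ d k * T m
          ≈⟨ *-cong (sym (power m≤k)) (T-geom m≤t) ⟩
        (x ^ᴿ d m) ^ᴿ (q ^ (k ∸ m)) * geom (x ^ᴿ d m) (q ^ (t ∸ m))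
          ≈⟨ ^-fixed (q ^ (k ∸ m)) (geom-fixed (x ^ᴿ d m) (q ^ (t ∸ m)) (trans (power m≤t) xⁿ≈1)) ⟩
        geom (x ^ᴿ d m) (q ^ (t ∸ m))
          ≈⟨ T-geom m≤t ⟨
        T m
          ∎
        where
        m≤t = ℕ.≤-trans m≤k k≤t
        power : ∀ {k} → m ≤ k → (x ^ᴿ d m) ^ᴿ (q ^ (k ∸ m)) ≈ x ^ᴿ d k
        power {k} m≤k = trans (^-assocʳ x (d m) (q ^ (k ∸ m)))
          (^-congʳ x (≡.trans (ℕ.*-comm (d m) _) (d-∸ m≤k)))

      T-absorb : ∀ {m k} → m ≤ k → k ≤ t → T k * T m ≈ ι (+ (q ^ (t ∸ k))) * T m
      T-absorb {m} {k} m≤k k≤t = trans (*-congʳ (T-geom k≤t))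
        (geom-absorb ι-homo (q ^ (t ∸ k)) (T-fixed m≤k k≤t))

      ∑-tail : ∀ {j} → j < t → ∑ R (filter (j <?_) (upTo (suc t))) χ ≈ T (suc j)
      ∑-tail {j} j<t = trans (∑-above χ j<t)
        (telescope χ T χ-+ χ-last (t ∸ suc j) (suc j) (ℕ.m+[n∸m]≡n j<t))

    -- Let `C` be the coset sum, `A` and `B` the sums `T j` and `T (suc j)`, so `A ≈ C + B`. Using
    -- `C * B ≈ c * C` and `C * A ≈ e * A`, the product `C * A` is both `C * C + c * C` and
    -- `e * C + e * B`. As `e` is `f + c`, the term `c * C` cancels.
    cosetSum-square : ∀ {j} → j < t →
      χ j ^ᴿ 2 ≈ ι ((+ q ℤ.- + 2) ℤ.* + (q ^ (t ∸ j ∸ 1))) * χ j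
                 + ι (+ φ (q ^ (t ∸ j))) * ∑ R (filter (j <?_) (upTo (suc t))) χ
    cosetSum-square {j} j<t = trans (*-congˡ (*-identityʳ C)) (+-cancelʳ (c * C) _ _ (begin
      C * C + c * C              ≈⟨ +-congˡ CB ⟨
      C * C + C * B              ≈⟨ distribˡ C C B ⟨
      C * (C + B)                ≈⟨ *-congˡ C+B ⟩
      C * A                      ≈⟨ CA ⟩
      e * A                      ≈⟨ *-congˡ C+B ⟨
      e * (C + B)                ≈⟨ distribˡ e C B ⟩
      e * C + e * B              ≈⟨ +-congʳ (*-congʳ e-split) ⟩
      (f + c) * C + e * B        ≈⟨ +-congʳ (distribʳ C f c) ⟩
      f * C + c * C + e * B      ≈⟨ +-assoc _ _ _ ⟩
      f * C + (c * C + e * B)    ≈⟨ +-congˡ (+-comm _ _) ⟩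
      f * C + (e * B + c * C)    ≈⟨ +-assoc _ _ _ ⟨
      f * C + e * B + c * C      ≈⟨ +-congʳ (+-congˡ (*-congˡ (∑-tail j<t))) ⟨
      f * C + e * S + c * C      ∎))
      where
      k = t ∸ j ∸ 1
      C = χ j
      A = T j
      B = T (suc j)
      S = ∑ R (filter (j <?_) (upTo (suc t))) χ
      -- These are the images of q^k, (q-1)q^k and (q-2)q^k, so `e` is `f + c` and the image of
      -- q^(k+1) is `e + c`.
      c = ι (+ (q ^ k))
      e = ι (+ φ (q ^ (t ∸ j)))
      f = ι ((+ q ℤ.- + 2) ℤ.* + (q ^ k))

      C+B : C + B ≈ A
      C+B = χ-+ j<t

      t∸j : t ∸ j ≡ suc k
      t∸j = ≡.sym (ℕ.suc-pred (t ∸ j) {{ℕ.>-nonZero (ℕ.m<n⇒0<n∸m j<t)}})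
      t∸1+j : t ∸ suc j ≡ k
      t∸1+j = ≡.trans (cong (t ∸_) (ℕ.+-comm 1 j)) (≡.sym (ℕ.∸-+-assoc t j 1))

      φ-value : + φ (q ^ (t ∸ j)) ≡ (+ q ℤ.- + 1) ℤ.* + (q ^ k)
      φ-value = ≡.trans (cong (λ i → + φ (q ^ i)) t∸j) (φ-prime-power q-prime k)

      BA : B * A ≈ c * A
      BA = trans (T-absorb (ℕ.n≤1+n j) j<t) (*-congʳ (reflexive (cong (λ i → ι (+ (q ^ i))) t∸1+j)))
      BB : B * B ≈ c * B
      BB = trans (T-absorb ℕ.≤-refl j<t) (*-congʳ (reflexive (cong (λ i → ι (+ (q ^ i))) t∸1+j)))
      AA : A * A ≈ ι (+ (q ^ suc k)) * A
      AA = trans (T-absorb ℕ.≤-refl (ℕ.<⇒≤ j<t)) (*-congʳ (reflexive (cong (λ i → ι (+ (q ^ i))) t∸j)))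

      e-split : e ≈ f + c
      e-split = trans (reflexive (cong ι (≡.trans φ-value (split (+ q) (+ (q ^ k))))))
                      (+-homo _ _)
        where
        split : ∀ a b → (a ℤ.- + 1) ℤ.* b ≡ (a ℤ.- + 2) ℤ.* b ℤ.+ b
        split = solve-∀

      q^-split : ι (+ (q ^ suc k)) ≈ e + c
      q^-split = trans (reflexive (cong ι (≡.trans (≡.trans (ℤ.pos-* q (q ^ k)) (split (+ q) (+ (q ^ k))))
                   (cong (λ i → i ℤ.+ + (q ^ k)) (≡.sym φ-value)))))
                   (+-homo _ _)
        where
        split : ∀ a b → a ℤ.* b ≡ (a ℤ.- + 1) ℤ.* b ℤ.+ b
        split = solve-∀

      -- Multiplication by `B` scales both `A` and `B` by `c`, hence also their difference `C`.
      CB : C * B ≈ c * C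
      CB = +-cancelʳ (c * B) _ _ (begin
        C * B + c * B  ≈⟨ +-congˡ BB ⟨
        C * B + B * B  ≈⟨ distribʳ B C B ⟨
        (C + B) * B    ≈⟨ *-congʳ C+B ⟩
        A * B          ≈⟨ *-comm A B ⟩
        B * A          ≈⟨ BA ⟩
        c * A          ≈⟨ *-congˡ C+B ⟨
        c * (C + B)    ≈⟨ distribˡ c C B ⟩
        c * C + c * B  ∎)

      -- `A * A` and `B * A` are the multiples of `A` by q^(k+1) and by `c`; these factors differ by
      -- `e`.
      CA : C * A ≈ e * A
      CA = +-cancelʳ (c * A) _ _ (begin
        C * A + c * A          ≈⟨ +-congˡ BA ⟨
        C * A + B * A          ≈⟨ distribʳ A C B ⟨
        (C + B) * A            ≈⟨ *-congʳ C+B ⟩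
        A * A                  ≈⟨ AA ⟩
        ι (+ (q ^ suc k)) * A  ≈⟨ *-congʳ q^-split ⟩
        (e + c) * A            ≈⟨ distribʳ A e c ⟩
        e * A + c * A          ∎)

-- Passing to the ring of polynomials modulo x^n - 1.

module _ {c ℓ} (R : CommutativeRing c ℓ) where
  open CommutativeRing R
  open SemiringDivisibility semiring using (_,_)
  open Exp semiring using () renaming (_^_ to _^ᴿ_)

  ≈⇒≈-quotient : ∀ {a x y} → x ≈ y → CommutativeRing._≈_ (R /⟨ a ⟩) x y
  ≈⇒≈-quotient {a} {x} {y} x≈y = Quotient.congruent
    (0# , trans (zeroˡ a) (sym (trans (+-congʳ x≈y) (-‿inverseʳ y))))

  -- The difference is `1#` times the generator of the ideal. Powers taken in the quotient and in
  -- `R` are identified by induction on the exponent.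
  ^-quotient≈1 : ∀ x n → let open Exp (CommutativeRing.semiring (R /⟨ x ^ᴿ n - 1# ⟩))
                                   using () renaming (_^_ to _^ꟴ_)
                         in CommutativeRing._≈_ (R /⟨ x ^ᴿ n - 1# ⟩) (x ^ꟴ n) 1#
  ^-quotient≈1 x n = Quotient.congruent (1# , trans (*-identityˡ _)
    (+-congʳ (reflexive (≡.sym (same-power n)))))
    where
    open Exp (CommutativeRing.semiring (R /⟨ x ^ᴿ n - 1# ⟩)) using () renaming (_^_ to _^ꟴ_)
    same-power : ∀ m → x ^ꟴ m ≡ x ^ᴿ m
    same-power zero    = ≡.refl
    same-power (suc m) = cong (x *_) (same-power m)

⟦⟧-homo : ∀ l n → let open CyclicRing l n in
          RingMorphisms.IsRingHomomorphism ℤ.+-*-rawRing (CommutativeRing.rawRing 𝔽ₗ[x]/⟨xⁿ-1⟩) ⟦_⟧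
⟦⟧-homo l n = record
  { isSemiringHomomorphism = record
    { isNearSemiringHomomorphism = record
      { +-isMonoidHomomorphism = record
        { isMagmaHomomorphism = record
          { isRelHomomorphism = record { cong = λ a≡b → R.reflexive (cong ⟦_⟧ a≡b) }
          ; homo = λ a b → R.refl
          }
        -- The constant 0 is a list with one zero, whereas the zero polynomial is `[]`; they agree
        -- only coefficientwise.
        ; ε-homo = lift (coeffwise λ { zero → F.refl ; (suc k) → F.refl })
        }
      -- In degree 0 the product of two constants computes to their product plus 0.
      ; *-homo = λ a b → lift (coeffwise λ { zero → F.sym (F.+-identityʳ (a ℤ.* b)) ; (suc k) → F.refl })
      }
    ; 1#-homo = R.refl
    }
  ; -‿homo = λ a → R.refl
  }
  where
  open CyclicRing l n
  open Polynomial (ℤ/ l)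
  module F = CommutativeRing (ℤ/ l)
  module R = CommutativeRing 𝔽ₗ[x]/⟨xⁿ-1⟩
  lift : ∀ {f g} → f ≈ₚ g → f R.≈ g
  lift = ≈⇒≈-quotient commutativeRing

theorem4p4 : ∀ (s t : ℕ) → 1 ≤ s → 1 ≤ t →
  ∀ (p q l : ℕ) → Prime p → Prime q → Prime l →
  p ≢ q → p ≢ l → q ≢ l →
  2 ∤ p → 2 ∤ q → p % 4 ≡ 3 →
  IsOrder (p ^ s) l (φ (p ^ s) / 2) →
  IsOrder (q ^ t) l (φ (q ^ t)) →
  gcd (φ (p ^ s)) (φ (q ^ t)) ≡ 2 →
  ∀ (j : ℕ) → j ≤ t ∸ 1 →
  let open CyclicRing l (p ^ s ℕ.* q ^ t)
      open CommutativeRing 𝔽ₗ[x]/⟨xⁿ-1⟩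
      open Exp semiring using () renaming (_^_ to _^ᴿ_)
      χ : ℕ → Carrier
      χ m = cosetSum (+ (p ^ s ℕ.* q ^ m))
  in χ j ^ᴿ 2
       ≈ ⟦ (+ q ℤ.- + 2) ℤ.* + (q ^ (t ∸ j ∸ 1)) ⟧ * χ j
         + ⟦ + φ (q ^ (t ∸ j)) ⟧ * ∑ 𝔽ₗ[x]/⟨xⁿ-1⟩ (filter (j <?_) (upTo (suc t))) χ
theorem4p4 s t _ 1≤t p q l p-prime q-prime l-prime _ _ q≢l _ _ _ _ ord-q _ j j≤t-1 =
  -- Here `P` is `p ^ s`, `ι` is the map `⟦_⟧` to constants and `x` is the class of the
  -- indeterminate.
  cosetSum-square {{ℕ.m^n≢0 p s {{prime⇒nonZero p-prime}}}} q-prime q∤l 1≤t ord-q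
    𝔽ₗ[x]/⟨xⁿ-1⟩ (⟦⟧-homo l (p ^ s ℕ.* q ^ t))
    (^-quotient≈1 (Polynomial.commutativeRing (ℤ/ l)) (Polynomial.X (ℤ/ l)) (p ^ s ℕ.* q ^ t)) j<t
  where
  open CyclicRing l (p ^ s ℕ.* q ^ t)
  q∤l : q ∤ l
  q∤l q∣l with prime⇒irreducible l-prime q∣l
  ... | inj₁ q≡1 = ℕ.nonTrivial⇒≢1 {{prime⇒nonTrivial q-prime}} q≡1
  ... | inj₂ q≡l = q≢l q≡l
  j<t : j < t
  -- By `1 ≤ t` the successor of `t ∸ 1` is `t`, so truncation at 0 does not interfere.
  j<t = subst (suc j ≤_) (ℕ.suc-pred t {{ℕ.>-nonZero 1≤t}}) (ℕ.s≤s j≤t-1)
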